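{- There is an absolute constant $c$ such that for every oriented tree $T$ of height $h$ with $1\le h\le 3$, with core $P_T$, there is a digraph $D_T$ with $|V_{D_T}|\le c\,|V_{P_T}|$ such that $(T,D_T)$ is a duality pair. In particular, since $|V_{P_T}|\le |V_T|$, $|V_{D_T}|\le c\,|V_T|$.
   Context: A homomorphism $G\to H$ of digraphs is a vertex map sending arcs to arcs. An oriented tree is an orientation of a (finite, undirected) tree. An ordered pair $(G,H)$ of digraphs is a duality pair if for every digraph $L$: $G\not\to L$ iff $L\to H$. A digraph is a core if it is not homomorphic to any proper subgraph of itself; the core of $G$ is a subgraph of $G$ that is a core and homomorphically equivalent to $G$. A connected digraph is balanced if every oriented cycle has equally many forward and backward arcs (oriented trees are balanced). For a connected balanced digraph, fix a vertex $x$ of in-degree $0$; the level of a vertex $v$ is the number of forward arcs minus backward arcs on any oriented path from $x$ to $v$ (normalized so the minimum level is $0$), and the height is the maximum level. -}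

module Defs where

open import Data.Bool using (Bool; T)
open import Data.Fin using (Fin)
open import Data.Integer as ℤ using (ℤ; +_; 0ℤ; 1ℤ)
open import Data.List using (List; []; _∷_; length)
open import Data.List.Relation.Unary.Unique.Propositional using (Unique)
open import Data.Nat using (ℕ; _≤_)
open import Data.Product using (Σ-syntax; ∃-syntax; ∃₂; _×_)
open import Data.Sum using (_⊎_)
open import Function.Bundles using (_⇔_)
open import Function.Definitions using (Injective)
open import Level using (0ℓ)
open import Relation.Binary.Construct.Closure.Equivalence using (EqClosure)
open import Relation.Binary.Construct.Closure.ReflexiveTransitive using (Star; ε; _◅_)
open import Relation.Binary.Construct.Closure.Symmetric using (SymClosure; fwd; bwd)
open import Relation.Binary.Core using (Rel; _Preserves_⟶_)
open import Relation.Binary.Definitions using (Asymmetric; Irreflexive; Symmetric)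
open import Relation.Binary.PropositionalEquality using (_≡_; _≢_)
open import Relation.Nullary using (¬_)

-- Digraphs are finite, given by an arbitrary 0/1 adjacency matrix: loops and
-- pairs of opposite arcs are allowed, parallel arcs are not.

record Digraph (n : ℕ) : Set where
  field
    arc : Fin n → Fin n → Bool

  Arc : Rel (Fin n) 0ℓ
  Arc u v = T (arc u v)

open Digraph public using (Arc)

infix 4 _⇝_

_⇝_ : ∀ {m n} → Digraph m → Digraph n → Set
_⇝_ {m} {n} G H = Σ[ f ∈ (Fin m → Fin n) ] f Preserves Arc G ⟶ Arc H

DualityPair : ∀ {m n} → Digraph m → Digraph n → Set
DualityPair G H = ∀ {k} (L : Digraph k) → (¬ (G ⇝ L)) ⇔ (L ⇝ H)

-- Since the vertices of a digraph are always an initial segment of ℕ, "H is a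
-- subgraph of G" is taken up to renaming of the vertices of H.

record Subgraph {m n} (H : Digraph m) (G : Digraph n) : Set where
  field
    embed           : Fin m → Fin n
    embed-injective : Injective _≡_ _≡_ embed
    embed-arc       : embed Preserves Arc H ⟶ Arc G

  -- Some vertex or some arc of G is missing from H.
  Proper : Set
  Proper =
    (∃[ v ] ∀ x → embed x ≢ v) ⊎
    (∃₂ λ u v → Arc G u v × (∀ x y → Arc H x y → ¬ (embed x ≡ u × embed y ≡ v)))

open Subgraph public using (Proper)

IsCore : ∀ {n} → Digraph n → Set
IsCore G = ∀ {m} (H : Digraph m) (s : Subgraph H G) → Proper s → ¬ (G ⇝ H)

record _IsCoreOf_ {m n} (P : Digraph m) (G : Digraph n) : Set where
  field
    subgraph : Subgraph P G
    isCore   : IsCore P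
    to       : G ⇝ P
    from     : P ⇝ G

-- Walks in a relation R are elements of Star R.

module _ {n : ℕ} {R : Rel (Fin n) 0ℓ} where

  vertices : ∀ {u v} → Star R u v → List (Fin n)
  vertices {u} ε       = u ∷ []
  vertices {u} (_ ◅ w) = u ∷ vertices w

  IsPath : ∀ {u v} → Star R u v → Set
  IsPath w = Unique (vertices w)

record Graph (n : ℕ) : Set where
  field
    edge : Fin n → Fin n → Bool

  Edge : Rel (Fin n) 0ℓ
  Edge u v = T (edge u v)

  field
    edge-sym    : Symmetric Edge
    edge-irrefl : Irreflexive _≡_ Edge

open Graph public using (Edge)

-- A cycle is a path u ⋯ v on at least three vertices closed up by an edge v u.

record IsTree {n} (U : Graph n) : Set where
  field
    nonempty  : Fin n
    connected : ∀ u v → Σ[ w ∈ Star (Edge U) u v ] IsPath w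
    acyclic   : ∀ {u v} (w : Star (Edge U) u v) → IsPath w →
                3 ≤ length (vertices w) → ¬ Edge U v u

-- Asymmetry: each edge receives exactly one of its two directions.

record _IsOrientationOf_ {n} (G : Digraph n) (U : Graph n) : Set where
  field
    underlying : ∀ u v → Edge U u v ⇔ SymClosure (Arc G) u v
    asymmetric : Asymmetric (Arc G)

IsOrientedTree : ∀ {n} → Digraph n → Set
IsOrientedTree {n} G = Σ[ U ∈ Graph n ] IsTree U × G IsOrientationOf U

-- An oriented walk in G is an element of EqClosure (Arc G): each step traverses
-- an arc forwards (fwd) or backwards (bwd).

netLength : ∀ {n} {R : Rel (Fin n) 0ℓ} {u v} → EqClosure R u v → ℤ
netLength ε           = 0ℤ
netLength (fwd _ ◅ w) = 1ℤ ℤ.+ netLength w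
netLength (bwd _ ◅ w) = ℤ.- 1ℤ ℤ.+ netLength w

-- Meaningful for connected balanced digraphs.  The shift is the normalization
-- that makes the minimum level 0.

record IsLevel {n} (G : Digraph n) (level : Fin n → ℕ) : Set where
  field
    root       : Fin n
    inDegree-0 : ∀ u → ¬ Arc G u root
    shift      : ℤ
    level-path : ∀ {v} (w : EqClosure (Arc G) root v) → IsPath w →
                 + level v ≡ netLength w ℤ.+ shift
    minimum    : ∃[ v ] level v ≡ 0

HasHeight : ∀ {n} → Digraph n → ℕ → Set
HasHeight G h =
  ∃[ level ] IsLevel G level × (∀ v → level v ≤ h) × (∃[ v ] level v ≡ h)

{-# OPTIONS --safe #-}

-- A tree T of height 3 maps onto a zigzag
--   x → u₀ → v₀ ← u₁ → v₁ ← ⋯ ← uⱼ → vⱼ → y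
-- with j least possible for T: send each vertex of level 1 or 2 to the position
-- given by its (capped) zigzag distance from the vertices of level 1 that have
-- an in-neighbour.  Minimality of j makes the v's of T, and of its core, distinct,
-- so the core has more than j vertices.  The zigzag has as its dual the oriented
-- cycle
--   a₀ → b₀ ← a₁ → b₁ ← ⋯ → bⱼ ← aⱼ₊₁ → a₀
-- on 2j + 3 vertices: if L contains no zigzag, the same capped distances
-- define a homomorphism from L to this cycle.  In heights 1 and 2 the tree is
-- equivalent to a directed path, whose dual has one or two vertices.

module Submission where

open import Defs
open import Data.Bool using (true; false)
open import Data.Empty using (⊥)
open import Data.Fin using (Fin; zero; suc; toℕ; fromℕ<; splitAt; join)
open import Data.Fin.Properties as Fin using (any?; injective⇒≤)
open import Data.Integer as ℤ using (+_; 1ℤ)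
open import Data.Integer.Properties as ℤ using (+-injective)
open import Data.Integer.Tactic.RingSolver using (solve-∀)
open import Data.List using ([]; _∷_; _++_; length)
open import Data.List.Membership.DecPropositional using (_∈?_)
open import Data.List.Membership.Propositional using (_∈_; _∉_)
open import Data.List.Relation.Binary.Subset.Propositional using (_⊆_)
open import Data.List.Relation.Binary.Subset.Propositional.Properties using (∷⁺ʳ)
open import Data.List.Relation.Unary.All using ([]; _∷_)
open import Data.List.Relation.Unary.All.Properties using (anti-mono)
open import Data.List.Relation.Unary.AllPairs using ([]; _∷_)
open import Data.List.Relation.Unary.Any using (here; there)
open import Data.List.Relation.Unary.Unique.Propositional using (Unique)
open import Data.List.Relation.Unary.Unique.Propositional.Properties using (++⁺)
open import Data.Nat using (ℕ; zero; suc; _+_; _*_; _∸_; _≤_; _<_; z≤n; s≤s)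
open import Data.Nat.Properties
open import Data.Product using (Σ-syntax; ∃-syntax; ∃₂; _×_; _,_; proj₁; proj₂)
open import Data.Sum using (_⊎_; inj₁; inj₂)
open import Data.Unit using (⊤; tt)
open import Function using (_∘_)
open import Function.Bundles using (_⇔_; mk⇔; Equivalence)
open import Level using (0ℓ)
open import Relation.Binary.Construct.Closure.Equivalence using (EqClosure)
open import Relation.Binary.Construct.Closure.ReflexiveTransitive as Star
  using (Star; ε; _◅_; _◅◅_)
open import Relation.Binary.Construct.Closure.Symmetric using (SymClosure; fwd; bwd)
open import Relation.Binary.Core using (Rel)
open import Relation.Binary.Definitions using (tri<; tri≈; tri>)
open import Relation.Binary.PropositionalEquality
open import Relation.Nullary using (¬_; Dec; yes; no; contradiction; ⌊_⌋)
open import Relation.Nullary.Decidable using (T?; _×-dec_; toWitness; fromWitness)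
open import Relation.Unary using (Pred; Decidable)

-- Levels of oriented trees

module _ {n : ℕ} {R : Rel (Fin n) 0ℓ} where

  -- The inclusion of `vertices w₁` carries the induction: it keeps the prefix free of repetitions
  -- when a vertex is put in front.
  split-path : ∀ {r u v} (w : Star R r u) → IsPath w → v ∈ vertices w →
               Σ[ w₁ ∈ Star R r v ] Σ[ w₂ ∈ Star R v u ]
                 w ≡ w₁ ◅◅ w₂ × IsPath w₁ × IsPath w₂ × vertices w₁ ⊆ vertices w
  split-path ε       uniq (here refl) = ε , ε , refl , uniq , uniq , λ z → z
  split-path (e ◅ w) uniq (here refl) =
    ε , e ◅ w , refl , [] ∷ [] , uniq , λ { (here eq) → here eq }
  split-path (e ◅ w) (r∉ ∷ uniq) (there v∈)
    with w₁ , w₂ , refl , uniq₁ , uniq₂ , sub ← split-path w uniq v∈ =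
    e ◅ w₁ , w₂ , refl , anti-mono sub r∉ ∷ uniq₁ , uniq₂ , ∷⁺ʳ _ sub

  vertices-snoc : ∀ {r u v} (w : Star R r u) (e : R u v) →
                  vertices (w ◅◅ e ◅ ε) ≡ vertices w ++ v ∷ []
  vertices-snoc ε       e = refl
  vertices-snoc (d ◅ w) e = cong (_ ∷_) (vertices-snoc w e)

  snoc-path : ∀ {r u v} (w : Star R r u) (e : R u v) →
              IsPath w → v ∉ vertices w → IsPath (w ◅◅ e ◅ ε)
  snoc-path w e uniq v∉ = subst Unique (sym (vertices-snoc w e))
    (++⁺ uniq ([] ∷ []) λ { (v∈ , here refl) → v∉ v∈ })

  vertices-map : ∀ {S : Rel (Fin n) 0ℓ} (f : ∀ {u v} → R u v → S u v) {u v}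
                 (w : Star R u v) → vertices (Star.map f w) ≡ vertices w
  vertices-map f ε       = refl
  vertices-map f (e ◅ w) = cong (_ ∷_) (vertices-map f w)

netLength-◅◅ : ∀ {n} {R : Rel (Fin n) 0ℓ} {u v x}
               (w : EqClosure R u v) (w′ : EqClosure R v x) →
               netLength (w ◅◅ w′) ≡ netLength w ℤ.+ netLength w′
netLength-◅◅ ε           w′ = sym (ℤ.+-identityˡ _)
netLength-◅◅ (fwd _ ◅ w) w′ =
  trans (cong (λ z → 1ℤ ℤ.+ z) (netLength-◅◅ w w′))
        (sym (ℤ.+-assoc 1ℤ (netLength w) (netLength w′)))
netLength-◅◅ (bwd _ ◅ w) w′ =
  trans (cong (λ z → ℤ.- 1ℤ ℤ.+ z) (netLength-◅◅ w w′))
        (sym (ℤ.+-assoc (ℤ.- 1ℤ) (netLength w) (netLength w′)))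

IsGrading : ∀ {n} → Digraph n → (Fin n → ℕ) → Set
IsGrading G level = ∀ {u v} → Arc G u v → level v ≡ suc (level u)

module OrientedTree {n} (T : Digraph n) {U : Graph n}
                    (tree : IsTree U) (orientation : T IsOrientationOf U) where

  open IsTree tree
  open _IsOrientationOf_ orientation

  orient : ∀ {u v} → Edge U u v → SymClosure (Arc T) u v
  orient = Equivalence.to (underlying _ _)

  unorient : ∀ {u v} → SymClosure (Arc T) u v → Edge U u v
  unorient = Equivalence.from (underlying _ _)

  path : ∀ u v → Σ[ w ∈ EqClosure (Arc T) u v ] IsPath w
  path u v with w , uniq ← connected u v =
    Star.map orient w , subst Unique (sym (vertices-map orient w)) uniq

  -- On three or more vertices, the path would be closed into a cycle by the arc. Asymmetry excludes
  -- the other short walks, so the path is the arc itself reversed.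
  netLength-path-along-arc : ∀ {u v} → Arc T u v → (w : EqClosure (Arc T) v u) →
                             IsPath w → netLength w ≡ ℤ.- 1ℤ
  netLength-path-along-arc a ε              _    = contradiction a (asymmetric a)
  netLength-path-along-arc a (fwd b ◅ ε)    _    = contradiction b (asymmetric a)
  netLength-path-along-arc a (bwd _ ◅ ε)    _    = refl
  netLength-path-along-arc a w@(_ ◅ _ ◅ w′) uniq =
    contradiction (unorient (fwd a))
      (acyclic (Star.map unorient w)
        (subst Unique (sym eq) uniq)
        (subst (λ xs → 3 ≤ length xs) (sym eq) (s≤s (s≤s (nonempty-vertices w′)))))
    where
    eq = vertices-map unorient w
    nonempty-vertices : ∀ {u v} (w : EqClosure (Arc T) u v) → 1 ≤ length (vertices w)
    nonempty-vertices ε       = s≤s z≤n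
    nonempty-vertices (_ ◅ _) = s≤s z≤n

  -- If `v` is off the path from the root to `u`, the arc extends that path. Otherwise the path
  -- reaches `u` through `v`, and its tail from `v` is the arc reversed.
  level-grading : ∀ {level} → IsLevel T level → IsGrading T level
  level-grading {level} isLevel {u} {v} a
    with w , uniq ← path (IsLevel.root isLevel) u
    with _∈?_ Fin._≟_ v (vertices w)
  ... | no v∉ = +-injective (begin
    + level v                               ≡⟨ level-path _ (snoc-path w (fwd a) uniq v∉) ⟩
    netLength (w ◅◅ fwd a ◅ ε) ℤ.+ shift    ≡⟨ cong (λ z → z ℤ.+ shift) (netLength-◅◅ w (fwd a ◅ ε)) ⟩
    (netLength w ℤ.+ 1ℤ) ℤ.+ shift          ≡⟨ move-one (netLength w) shift ⟩
    1ℤ ℤ.+ (netLength w ℤ.+ shift)          ≡⟨ cong (λ z → 1ℤ ℤ.+ z) (level-path w uniq) ⟨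
    + suc (level u)                         ∎)
    where
    open ≡-Reasoning
    open IsLevel isLevel
    move-one : ∀ x s → (x ℤ.+ 1ℤ) ℤ.+ s ≡ 1ℤ ℤ.+ (x ℤ.+ s)
    move-one = solve-∀
  ... | yes v∈
    with w₁ , w₂ , refl , uniq₁ , uniq₂ , _ ← split-path w uniq v∈ = +-injective (begin
    + level v                                                ≡⟨ level-path w₁ uniq₁ ⟩
    netLength w₁ ℤ.+ shift                                   ≡⟨ cancel-one (netLength w₁) shift ⟩
    1ℤ ℤ.+ ((netLength w₁ ℤ.+ ℤ.- 1ℤ) ℤ.+ shift)             ≡⟨ cong (λ z → 1ℤ ℤ.+ ((netLength w₁ ℤ.+ z) ℤ.+ shift))
                                                                  (netLength-path-along-arc a w₂ uniq₂) ⟨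
    1ℤ ℤ.+ ((netLength w₁ ℤ.+ netLength w₂) ℤ.+ shift)       ≡⟨ cong (λ z → 1ℤ ℤ.+ (z ℤ.+ shift)) (netLength-◅◅ w₁ w₂) ⟨
    1ℤ ℤ.+ (netLength (w₁ ◅◅ w₂) ℤ.+ shift)                  ≡⟨ cong (λ z → 1ℤ ℤ.+ z) (level-path _ uniq) ⟨
    + suc (level u)                                          ∎)
    where
    open ≡-Reasoning
    open IsLevel isLevel
    cancel-one : ∀ x s → x ℤ.+ s ≡ 1ℤ ℤ.+ ((x ℤ.+ ℤ.- 1ℤ) ℤ.+ s)
    cancel-one = solve-∀

-- `C` is an early exit: the walk carries the invariant `P` until some step produces the object
-- sought.
propagate : ∀ {n} {R : Rel (Fin n) 0ℓ} {P : Pred (Fin n) 0ℓ} {C : Set} →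
            (∀ {u v} → P u → SymClosure R u v → P v ⊎ C) →
            ∀ {u v} → P u → EqClosure R u v → P v ⊎ C
propagate step p ε = inj₁ p
propagate step p (e ◅ w) with step p e
... | inj₁ q = propagate step q w
... | inj₂ c = inj₂ c

-- Capped least witnesses

rank : ∀ {P : Pred ℕ 0ℓ} → Decidable P → ℕ → ℕ
rank P? zero    = zero
rank P? (suc b) with P? 0
... | yes _ = zero
... | no  _ = suc (rank (P? ∘ suc) b)

rank-≤ : ∀ {P : Pred ℕ 0ℓ} (P? : Decidable P) b → rank P? b ≤ b
rank-≤ P? zero    = z≤n
rank-≤ P? (suc b) with P? 0
... | yes _ = z≤n
... | no  _ = s≤s (rank-≤ (P? ∘ suc) b)

rank-least : ∀ {P : Pred ℕ 0ℓ} (P? : Decidable P) b {i} → P i → rank P? b ≤ i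
rank-least P? zero    p = z≤n
rank-least P? (suc b) p with P? 0
rank-least P? (suc b)         p | yes _ = z≤n
rank-least P? (suc b) {zero}  p | no ¬p = contradiction p ¬p
rank-least P? (suc b) {suc i} p | no _  = s≤s (rank-least (P? ∘ suc) b p)

rank-holds : ∀ {P : Pred ℕ 0ℓ} (P? : Decidable P) b → rank P? b < b → P (rank P? b)
rank-holds P? (suc b) lt with P? 0
rank-holds P? (suc b) lt       | yes p = p
rank-holds P? (suc b) (s≤s lt) | no _  = rank-holds (P? ∘ suc) b lt

rank-holds⊎cap : ∀ {P : Pred ℕ 0ℓ} (P? : Decidable P) b → P (rank P? b) ⊎ rank P? b ≡ b
rank-holds⊎cap P? b with m≤n⇒m<n∨m≡n (rank-≤ P? b)
... | inj₁ lt = inj₁ (rank-holds P? b lt)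
... | inj₂ eq = inj₂ eq

rank-cap : ∀ {P : Pred ℕ 0ℓ} (P? : Decidable P) b → (∀ i → i < b → ¬ P i) → rank P? b ≡ b
rank-cap P? b none with m≤n⇒m<n∨m≡n (rank-≤ P? b)
... | inj₁ lt = contradiction (rank-holds P? b lt) (none _ lt)
... | inj₂ eq = eq

least : ∀ {P : Pred ℕ 0ℓ} → Decidable P → ∀ {b} → P b → ∃[ m ] P m × (∀ i → i < m → ¬ P i)
least {P} P? {b} p = rank P? b , holds , λ i i<m q → <⇒≱ i<m (rank-least P? b q)
  where
  holds : P (rank P? b)
  -- The known witness `b` serves as the cap, so a rank equal to the cap is a witness too.
  holds with rank-holds⊎cap P? b
  ... | inj₁ q  = q
  ... | inj₂ eq = subst P (sym eq) p

-- Zigzags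

HasIn HasOut : ∀ {n} → Digraph n → Fin n → Set
HasIn  G v = ∃[ x ] Arc G x v
HasOut G v = ∃[ y ] Arc G v y

hasOut? : ∀ {n} (G : Digraph n) → Decidable (HasOut G)
hasOut? G v = any? λ y → T? (Digraph.arc G v y)

-- Lower G i and Upper G i hold of the possible images of uᵢ and vᵢ.
mutual
  Lower : ∀ {n} → Digraph n → ℕ → Fin n → Set
  Lower G zero    u = HasIn G u
  Lower G (suc i) u = ∃[ v ] Upper G i v × Arc G u v

  Upper : ∀ {n} → Digraph n → ℕ → Fin n → Set
  Upper G i v = ∃[ u ] Lower G i u × Arc G u v

Zigzag : ∀ {n} → Digraph n → ℕ → Set
Zigzag G j = ∃[ v ] Upper G j v × HasOut G v

mutual
  lower? : ∀ {n} (G : Digraph n) u → Decidable (λ i → Lower G i u)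
  lower? G u zero    = any? λ x → T? (Digraph.arc G x u)
  lower? G u (suc i) = any? λ v → upper? G v i ×-dec T? (Digraph.arc G u v)

  upper? : ∀ {n} (G : Digraph n) v → Decidable (λ i → Upper G i v)
  upper? G v i = any? λ u → lower? G u i ×-dec T? (Digraph.arc G u v)

zigzag? : ∀ {n} (G : Digraph n) → Decidable (Zigzag G)
zigzag? G j = any? λ v → upper? G v j ×-dec hasOut? G v

-- The last arc is traversed back and forth once more. Hence containing a zigzag is monotone in its
-- index.
upper-suc : ∀ {n} (G : Digraph n) i {v} → Upper G i v → Upper G (suc i) v
upper-suc G i (u , l , a) = u , (_ , (u , l , a) , a) , a

zigzag-≤ : ∀ {n} (G : Digraph n) {i j} → i ≤ j → Zigzag G i → Zigzag G j
zigzag-≤ G {i} {j} i≤j (v , r , o) =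
  v , subst (λ k → Upper G k v) (m∸n+n≡m i≤j) (go (j ∸ i)) , o
  where
  go : ∀ k → Upper G (k + i) v
  go zero    = r
  go (suc k) = upper-suc G (k + i) (go k)

module _ {m n} (G : Digraph m) (H : Digraph n) (hom : G ⇝ H) where

  private
    f = proj₁ hom
    f-arc = proj₂ hom

  mutual
    lower-hom : ∀ i {u} → Lower G i u → Lower H i (f u)
    lower-hom zero    (x , a)     = f x , f-arc a
    lower-hom (suc i) (v , r , a) = f v , upper-hom i r , f-arc a

    upper-hom : ∀ i {v} → Upper G i v → Upper H i (f v)
    upper-hom i (u , l , a) = f u , lower-hom i l , f-arc a

  zigzag-hom : ∀ {j} → Zigzag G j → Zigzag H j
  zigzag-hom {j} (v , r , y , a) = f v , upper-hom j r , f y , f-arc a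

-- Capped zigzag distances across an arc

module Ranks {n} (G : Digraph n) (b : ℕ) where

  lowerRank upperRank : Fin n → ℕ
  lowerRank u = rank (lower? G u) b
  upperRank v = rank (upper? G v) b

  -- A zigzag to `u` extends along the arc to `v`; at the cap the bound is trivial. Together with
  -- `lowerRank≤1+upperRank`, the ranks across an arc are related like the indices in uᵢ → vᵢ or
  -- uᵢ₊₁ → vᵢ.
  upperRank≤lowerRank : ∀ {u v} → Arc G u v → upperRank v ≤ lowerRank u
  upperRank≤lowerRank {u} {v} a with rank-holds⊎cap (lower? G u) b
  ... | inj₁ l  = rank-least (upper? G v) b (u , l , a)
  ... | inj₂ eq = subst (upperRank v ≤_) (sym eq) (rank-≤ (upper? G v) b)

  lowerRank≤1+upperRank : ∀ {u v} → Arc G u v → lowerRank u ≤ suc (upperRank v)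
  lowerRank≤1+upperRank {u} {v} a with rank-holds⊎cap (upper? G v) b
  ... | inj₁ r  = rank-least (lower? G u) b (v , r , a)
  ... | inj₂ eq = subst (λ k → lowerRank u ≤ suc k) (sym eq) (m≤n⇒m≤1+n (rank-≤ (lower? G u) b))

  lowerRank-HasIn : ∀ {u} → HasIn G u → lowerRank u ≡ 0
  lowerRank-HasIn {u} l = n≤0⇒n≡0 (rank-least (lower? G u) b l)

-- The vertices of a zigzag are numbered backwards, from its end v, so that the
-- witness of Upper G j v can be unfolded by structural recursion.
record Course {n} (G : Digraph n) (j : ℕ) (v : Fin n) : Set where
  field
    start        : Fin n
    lower upper  : ℕ → Fin n
    lower-start  : Arc G start (lower j)
    upper-end    : upper 0 ≡ v
    down         : ∀ {d} → d ≤ j → Arc G (lower d) (upper d)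
    up           : ∀ {d} → d < j → Arc G (lower d) (upper (suc d))

course : ∀ {n} (G : Digraph n) j {v} → Upper G j v → Course G j v
course G zero {v} (u , (x , xu) , uv) = record
  { start       = x
  -- Only index 0 is constrained here; the other values are dummies.
  ; lower       = λ _ → u
  ; upper       = λ _ → v
  ; lower-start = xu
  ; upper-end   = refl
  ; down        = λ _ → uv
  ; up          = λ ()
  }
course G (suc j) {v} (u , (v′ , r , uv′) , uv) = record
  { start       = C.start
  ; lower       = λ { zero → u ; (suc d) → C.lower d }
  ; upper       = λ { zero → v ; (suc d) → C.upper d }
  ; lower-start = C.lower-start
  ; upper-end   = refl
  ; down        = λ { {zero} _ → uv ; {suc _} (s≤s d≤j) → C.down d≤j }
  ; up          = λ { {zero} _ → subst (Arc G u) (sym C.upper-end) uv′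
                    ; {suc _} (s≤s d<j) → C.up d<j }
  }
  where module C = Course (course G j r)

-- Shortest zigzags

module _ {n} (G : Digraph n) where

  -- Just before `v`, the chain has a vertex `v′` of least index one smaller, since a shorter chain
  -- to `v′` would shorten the one to `v`. Going back therefore meets every least index up to `j`.
  shortest-visits-ranks : ∀ j {v} → Upper G j v → (∀ i → i < j → ¬ Upper G i v) →
    ∀ i → i ≤ j → ∃[ w ] Upper G i w × (∀ k → k < i → ¬ Upper G k w)
  shortest-visits-ranks j {v} r none i i≤j with m≤n⇒m<n∨m≡n i≤j
  ... | inj₂ refl = v , r , none
  shortest-visits-ranks (suc j) (u , (v′ , r , uv′) , uv) none i _ | inj₁ (s≤s i≤j) =
    shortest-visits-ranks j r
      (λ k k<j q → none (suc k) (s≤s k<j) (u , (v′ , q , uv′) , uv)) i i≤j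

  -- A shorter chain to the end `v` would give a shorter zigzag through the same out-arc, so `j` is
  -- the least index of `v`. Going back from `v` yields vertices of least indices 0 to `j`, which
  -- are distinct.
  shortest-zigzag-< : ∀ {j} → Zigzag G j → (∀ i → i < j → ¬ Zigzag G i) → j < n
  shortest-zigzag-< {j} (v , r , o) none = injective⇒≤ {f = vertex} λ {a} {b} → vertex-injective a b
    where
    visit : (a : Fin (suc j)) →
            ∃[ w ] Upper G (toℕ a) w × (∀ k → k < toℕ a → ¬ Upper G k w)
    visit a = shortest-visits-ranks j r (λ i i<j q → none i i<j (v , q , o))
                (toℕ a) (Fin.toℕ≤pred[n] a)

    vertex : Fin (suc j) → Fin n
    vertex a = proj₁ (visit a)

    vertex-injective : ∀ a b → vertex a ≡ vertex b → a ≡ b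
    vertex-injective a b eq with <-cmp (toℕ a) (toℕ b)
    ... | tri≈ _ a≡b _ = Fin.toℕ-injective a≡b
    ... | tri< a<b _ _ = contradiction
      (subst (Upper G (toℕ a)) eq (proj₁ (proj₂ (visit a)))) (proj₂ (proj₂ (visit b)) _ a<b)
    ... | tri> _ _ b<a = contradiction
      (subst (Upper G (toℕ b)) (sym eq) (proj₁ (proj₂ (visit b)))) (proj₂ (proj₂ (visit a)) _ b<a)

-- The dual cycle

module Cycle (j : ℕ) where

  -- inj₁ i is the vertex aᵢ, inj₂ i the vertex bᵢ.
  Vertex : Set
  Vertex = Fin (suc (suc j)) ⊎ Fin (suc j)

  -- The first clause is the closing arc aⱼ₊₁ → a₀. The second gives aᵢ → bᵢ and aᵢ₊₁ → bᵢ, in the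
  -- form in which the rank inequalities supply them.
  _⟶_ : Vertex → Vertex → Set
  inj₁ a ⟶ inj₁ a′ = toℕ a ≡ suc j × toℕ a′ ≡ 0
  inj₁ a ⟶ inj₂ b  = toℕ b ≤ toℕ a × toℕ a ≤ suc (toℕ b)
  inj₂ _ ⟶ _       = ⊥

  _⟶?_ : ∀ x y → Dec (x ⟶ y)
  inj₁ a ⟶? inj₁ a′ = (toℕ a ≟ suc j) ×-dec (toℕ a′ ≟ 0)
  inj₁ a ⟶? inj₂ b  = (toℕ b ≤? toℕ a) ×-dec (toℕ a ≤? suc (toℕ b))
  inj₂ _ ⟶? _       = no λ ()

  decode : Fin (suc (suc j) + suc j) → Vertex
  decode = splitAt (suc (suc j))

  cycle : Digraph (suc (suc j) + suc j)
  cycle = record { arc = λ x y → ⌊ decode x ⟶? decode y ⌋ }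

  arc⇒⟶ : ∀ x y → Arc cycle x y → decode x ⟶ decode y
  arc⇒⟶ x y = toWitness {a? = decode x ⟶? decode y}

  encode : Vertex → Fin (suc (suc j) + suc j)
  encode = join (suc (suc j)) (suc j)

  decode-encode : ∀ x → decode (encode x) ≡ x
  decode-encode = Fin.splitAt-join (suc (suc j)) (suc j)

  ⟶⇒arc : ∀ x y → x ⟶ y → Arc cycle (encode x) (encode y)
  ⟶⇒arc x y s = fromWitness {a? = decode (encode x) ⟶? decode (encode y)}
    (subst₂ _⟶_ (sym (decode-encode x)) (sym (decode-encode y)) s)

  -- Invariants for the images of uᵢ and vᵢ with i ≤ j. The closing arc starts at aⱼ₊₁, which is
  -- still out of reach, so vᵢ falls on some b. The b's are sinks: a uᵢ placed there cannot be
  -- continued, and vⱼ has no arc to leave by.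
  LowerBound UpperBound : ℕ → Vertex → Set
  LowerBound i (inj₁ a) = toℕ a ≤ i
  LowerBound i (inj₂ _) = ⊤
  UpperBound i (inj₁ _) = ⊥
  UpperBound i (inj₂ b) = toℕ b ≤ i

  in⇒lowerBound : ∀ x y → x ⟶ y → LowerBound 0 y
  in⇒lowerBound (inj₁ _) (inj₁ _) (_ , eq) = ≤-reflexive eq
  in⇒lowerBound (inj₁ _) (inj₂ _) _        = tt

  upper-step : ∀ {i} → i ≤ j → ∀ x y → LowerBound i x → x ⟶ y → UpperBound i y
  upper-step i≤j (inj₁ a) (inj₁ _) a≤i (eq , _)  =
    <⇒≱ (s≤s i≤j) (subst (_≤ _) eq a≤i)
  upper-step i≤j (inj₁ a) (inj₂ b) a≤i (b≤a , _) = ≤-trans b≤a a≤i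

  lower-step : ∀ {i} → ∀ x y → UpperBound i y → x ⟶ y → LowerBound (suc i) x
  lower-step (inj₁ a) (inj₂ b) b≤i (_ , a≤1+b) = ≤-trans a≤1+b (s≤s b≤i)

  mutual
    lower⇒bound : ∀ i u → i ≤ j → Lower cycle i u → LowerBound i (decode u)
    lower⇒bound zero u _ (x , a) = in⇒lowerBound (decode x) (decode u) (arc⇒⟶ x u a)
    lower⇒bound (suc i) u i<j (v , r , a) =
      lower-step (decode u) (decode v) (upper⇒bound i v (<⇒≤ i<j) r) (arc⇒⟶ u v a)

    upper⇒bound : ∀ i v → i ≤ j → Upper cycle i v → UpperBound i (decode v)
    upper⇒bound i v i≤j (u , l , a) =
      upper-step i≤j (decode u) (decode v) (lower⇒bound i u i≤j l) (arc⇒⟶ u v a)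

  sink : ∀ {i} x y → UpperBound i x → ¬ (x ⟶ y)
  sink (inj₂ _) _ _ ()

  cycle-no-zigzag : ¬ Zigzag cycle j
  cycle-no-zigzag (v , r , y , a) =
    sink (decode v) (decode y) (upper⇒bound j v ≤-refl r) (arc⇒⟶ v y a)

  module _ {n} (L : Digraph n) (none : ¬ Zigzag L j) where

    -- The cap is the index of aⱼ₊₁, where the closing arc starts.
    open Ranks L (suc j)

    -- Without a zigzag, a vertex whose `upperRank` is below the cap has no out-neighbour and may go
    -- to a sink b; all others go to the a's by `lowerRank`.
    place : Fin n → Vertex
    place l with m≤n⇒m<n∨m≡n (rank-≤ (upper? L l) (suc j))
    ... | inj₁ r≤j = inj₂ (fromℕ< r≤j)
    ... | inj₂ _   = inj₁ (fromℕ< (s≤s (rank-≤ (lower? L l) (suc j))))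

    -- A smaller index would, with the out-arc, give a zigzag of index at most `j`, which lengthens
    -- to one of index `j`.
    upperRank-HasOut : ∀ {l} → HasOut L l → upperRank l ≡ suc j
    upperRank-HasOut {l} o = rank-cap (upper? L l) (suc j)
      λ { i (s≤s i≤j) r → none (zigzag-≤ L i≤j (l , r , o)) }

    place-arc : ∀ {k l} → Arc L k l → place k ⟶ place l
    place-arc {k} {l} a
      with m≤n⇒m<n∨m≡n (rank-≤ (upper? L k) (suc j)) | m≤n⇒m<n∨m≡n (rank-≤ (upper? L l) (suc j))
    ... | inj₁ lt | _ = contradiction lt (<-irrefl (upperRank-HasOut (l , a)))
    ... | inj₂ _  | inj₁ r≤j
      rewrite Fin.toℕ-fromℕ< r≤j | Fin.toℕ-fromℕ< (s≤s (rank-≤ (lower? L k) (suc j))) =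
      upperRank≤lowerRank a , lowerRank≤1+upperRank a
    -- The inequalities force `lowerRank k` up to the cap, while `l` has an in-neighbour and so
    -- `lowerRank` 0: this is the closing arc.
    ... | inj₂ _  | inj₂ eq
      rewrite Fin.toℕ-fromℕ< (s≤s (rank-≤ (lower? L k) (suc j)))
            | Fin.toℕ-fromℕ< (s≤s (rank-≤ (lower? L l) (suc j))) =
      ≤-antisym (rank-≤ (lower? L k) (suc j)) (subst (_≤ lowerRank k) eq (upperRank≤lowerRank a))
      , lowerRank-HasIn (k , a)

    no-zigzag⇒⇝cycle : L ⇝ cycle
    no-zigzag⇒⇝cycle = encode ∘ place , λ {k} {l} a → ⟶⇒arc (place k) (place l) (place-arc a)

-- Graded digraphs of small height

module Graded {n} {T : Digraph n} {level : Fin n → ℕ} (grading : IsGrading T level) where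

  arc-levels : ∀ {u v i} → Arc T u v → level u ≡ i → level v ≡ suc i
  arc-levels a eq = trans (grading a) (cong suc eq)

  arc-levels⁻ : ∀ {u v i} → Arc T u v → level v ≡ suc i → level u ≡ i
  arc-levels⁻ a eq = suc-injective (trans (sym (grading a)) eq)

  no-arc-into-0 : ∀ {u v} → Arc T u v → level v ≢ 0
  no-arc-into-0 a eq = contradiction (trans (sym (grading a)) eq) λ ()

  walk⇒arc : ∀ {u v} → level u ≡ 0 → level v ≡ 1 → EqClosure (Arc T) u v → ∃₂ (Arc T)
  walk⇒arc u≡0 v≡1 ε = contradiction (trans (sym u≡0) v≡1) λ ()
  walk⇒arc _   _   (fwd a ◅ _) = _ , _ , a
  walk⇒arc _   _   (bwd a ◅ _) = _ , _ , a

  -- As long as the walk stays on levels 0 and 1, it comes to level 1 only from below; its first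
  -- step to level 2 completes the path.
  walk⇒2-path : ∀ {u v} → level u ≡ 0 → level v ≡ 2 → EqClosure (Arc T) u v →
                ∃[ x ] HasIn T x × HasOut T x
  walk⇒2-path {v = v} u≡0 v≡2 w with propagate {P = P} step (inj₁ u≡0) w
    where
    P : Fin n → Set
    P x = level x ≡ 0 ⊎ level x ≡ 1 × HasIn T x
    step : ∀ {x y} → P x → SymClosure (Arc T) x y → P y ⊎ ∃[ z ] HasIn T z × HasOut T z
    step (inj₁ eq)       (fwd a) = inj₁ (inj₂ (arc-levels a eq , _ , a))
    step (inj₁ eq)       (bwd a) = contradiction eq (no-arc-into-0 a)
    step (inj₂ (_ , i))  (fwd a) = inj₂ (_ , i , _ , a)
    step (inj₂ (eq , _)) (bwd a) = inj₁ (inj₁ (arc-levels⁻ a eq))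
  ... | inj₂ c                = c
  ... | inj₁ (inj₁ v≡0)       = contradiction (trans (sym v≡0) v≡2) λ ()
  ... | inj₁ (inj₂ (v≡1 , _)) = contradiction (trans (sym v≡1) v≡2) λ ()

  -- Until it first steps to level 3, the walk itself traces a zigzag: each descent from level 2 to
  -- level 1 adds one to the index, and each ascent from level 0 restarts it at 0. The step to level
  -- 3 supplies the final out-arc.
  walk⇒zigzag : ∀ {u v} → level u ≡ 0 → level v ≡ 3 → EqClosure (Arc T) u v → ∃[ j ] Zigzag T j
  walk⇒zigzag {v = v} u≡0 v≡3 w with propagate {P = P} step (inj₁ u≡0) w
    where
    P : Fin n → Set
    P x = level x ≡ 0
        ⊎ level x ≡ 1 × (∃[ i ] Lower T i x)
        ⊎ level x ≡ 2 × (∃[ i ] Upper T i x)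
    step : ∀ {x y} → P x → SymClosure (Arc T) x y → P y ⊎ ∃[ j ] Zigzag T j
    step (inj₁ eq) (fwd a) = inj₁ (inj₂ (inj₁ (arc-levels a eq , 0 , _ , a)))
    step (inj₁ eq) (bwd a) = contradiction eq (no-arc-into-0 a)
    step (inj₂ (inj₁ (eq , i , l))) (fwd a) = inj₁ (inj₂ (inj₂ (arc-levels a eq , i , _ , l , a)))
    step (inj₂ (inj₁ (eq , i , l))) (bwd a) = inj₁ (inj₁ (arc-levels⁻ a eq))
    step (inj₂ (inj₂ (eq , i , r))) (fwd a) = inj₂ (i , _ , r , _ , a)
    step (inj₂ (inj₂ (eq , i , r))) (bwd a) =
      inj₁ (inj₂ (inj₁ (arc-levels⁻ a eq , suc i , _ , r , a)))
  ... | inj₂ c                       = c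
  ... | inj₁ (inj₁ v≡0)              = contradiction (trans (sym v≡0) v≡3) λ ()
  ... | inj₁ (inj₂ (inj₁ (v≡1 , _))) = contradiction (trans (sym v≡1) v≡3) λ ()
  ... | inj₁ (inj₂ (inj₂ (v≡2 , _))) = contradiction (trans (sym v≡2) v≡3) λ ()

  module _ {k} (L : Digraph k) where

    arc⇒⇝ : (∀ v → level v ≤ 1) → ∃₂ (Arc L) → T ⇝ L
    arc⇒⇝ bounded (x , y , xy) = f ∘ level , λ {u} {v} a → f-arc (grading a) (bounded v)
      where
      f : ℕ → Fin k
      f 0 = x
      f _ = y
      f-arc : ∀ {i i′} → i′ ≡ suc i → i′ ≤ 1 → Arc L (f i) (f i′)
      f-arc {zero}  refl _         = xy
      f-arc {suc _} refl (s≤s ())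

    2-path⇒⇝ : (∀ v → level v ≤ 2) → ∃[ z ] HasIn L z × HasOut L z → T ⇝ L
    2-path⇒⇝ bounded (z , (x , xz) , (y , zy)) =
      f ∘ level , λ {u} {v} a → f-arc (grading a) (bounded v)
      where
      f : ℕ → Fin k
      f 0 = x
      f 1 = z
      f _ = y
      f-arc : ∀ {i i′} → i′ ≡ suc i → i′ ≤ 2 → Arc L (f i) (f i′)
      f-arc {0}           refl _               = xz
      f-arc {1}           refl _               = zy
      f-arc {suc (suc _)} refl (s≤s (s≤s ()))

    -- Levels 0 and 3 go to the two ends, levels 1 and 2 to uᵢ and vᵢ by rank. As `T` has no zigzag
    -- of index below `j`, every vertex of level 2 with an out-neighbour lands on vⱼ, from which the
    -- arc to `y` leaves.
    zigzag⇒⇝ : (∀ v → level v ≤ 3) → ∀ {j} → (∀ i → i < j → ¬ Zigzag T i) →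
               Zigzag L j → T ⇝ L
    zigzag⇒⇝ bounded {j} none (v , r , y , vy) =
      (λ w → f w (level w)) , λ {w} {w′} a → f-arc a (level w) (grading a) (bounded w′)
      where
      open Course (course L j r)
      -- Capping at `j` keeps every rank among the indices of the zigzag; the subtractions from `j`
      -- below pass to the backward numbering of `Course`.
      open Ranks T j

      f : Fin n → ℕ → Fin k
      f w 0 = start
      f w 1 = lower (j ∸ lowerRank w)
      f w 2 = upper (j ∸ upperRank w)
      f w _ = y

      middle : ∀ {a b} → b ≤ a → a ≤ suc b → a ≤ j → Arc L (lower (j ∸ a)) (upper (j ∸ b))
      middle {a} {b} b≤a a≤1+b a≤j with m≤n⇒m<n∨m≡n b≤a
      ... | inj₂ refl = down (m∸n≤m j b)
      -- Here a = b + 1, so `j ∸ b` is the successor of `j ∸ a`, as `up` expects.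
      ... | inj₁ b<a with refl ← ≤-antisym a≤1+b b<a =
        subst (λ d → Arc L (lower (j ∸ suc b)) (upper d)) (sym (+-∸-assoc 1 a≤j))
          (up (∸-monoʳ-< {j} (s≤s z≤n) a≤j))

      f-arc : ∀ {w w′} → Arc T w w′ → ∀ i {i′} → i′ ≡ suc i → i′ ≤ 3 → Arc L (f w i) (f w′ i′)
      f-arc {w} {w′} a 0 refl _ =
        subst (λ d → Arc L start (lower (j ∸ d))) (sym (lowerRank-HasIn (w , a))) lower-start
      f-arc {w} {w′} a 1 refl _ =
        middle (upperRank≤lowerRank a) (lowerRank≤1+upperRank a) (rank-≤ (lower? T w) j)
      f-arc {w} {w′} a 2 refl _ = subst (λ x → Arc L x y) (sym end) vy
        where
        end : upper (j ∸ upperRank w) ≡ v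
        end = trans (cong (λ d → upper (j ∸ d))
                (rank-cap (upper? T w) j λ i i<j q → none i i<j (w , q , w′ , a)))
              (trans (cong upper (n∸n≡0 j)) upper-end)
      f-arc a (suc (suc (suc _))) refl (s≤s (s≤s (s≤s ())))

-- Duals in heights 1, 2 and 3

duality : ∀ {m n} (G : Digraph m) (H : Digraph n) (C : ∀ {k} → Digraph k → Set) →
          (∀ {k} (L : Digraph k) → C L → G ⇝ L) →
          (∀ {k} (L : Digraph k) → ¬ C L → L ⇝ H) →
          ¬ (G ⇝ H) → DualityPair G H
-- In the uses below, `C` says that a digraph contains an image of the path or zigzag equivalent to
-- `G`.
duality G H C found missing G↛H L = mk⇔
  (λ G↛L → missing L (G↛L ∘ found L))
  (λ (g , g-arc) (f , f-arc) → G↛H (g ∘ f , g-arc ∘ f-arc))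

point : Digraph 1
point = record { arc = λ _ _ → false }

arrow : Digraph 2
arrow = record { arc = λ { zero (suc zero) → true ; _ _ → false } }

no-arc⇒⇝point : ∀ {k} (L : Digraph k) → ¬ ∃₂ (Arc L) → L ⇝ point
no-arc⇒⇝point L none = (λ _ → zero) , λ a → none (_ , _ , a)

no-2-path⇒⇝arrow : ∀ {k} (L : Digraph k) → ¬ (∃[ z ] HasIn L z × HasOut L z) → L ⇝ arrow
no-2-path⇒⇝arrow {k} L none = f , f-arc
  where
  f : Fin k → Fin 2
  f v with hasOut? L v
  ... | yes _ = zero
  ... | no  _ = suc zero
  f-arc : ∀ {u v} → Arc L u v → Arc arrow (f u) (f v)
  f-arc {u} {v} a with hasOut? L u | hasOut? L v
  ... | yes _  | no _  = tt
  ... | no ¬o  | _     = ¬o (v , a)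
  ... | yes _  | yes o = none (v , (u , a) , o)

arrow-no-2-path : ¬ (∃[ z ] HasIn arrow z × HasOut arrow z)
arrow-no-2-path (zero     , (zero     , ()) , _)
arrow-no-2-path (zero     , (suc zero , ()) , _)
arrow-no-2-path (suc zero , _ , (zero     , ()))
arrow-no-2-path (suc zero , _ , (suc zero , ()))

graded-dual : ∀ {n} {T : Digraph n} {level : Fin n → ℕ} → IsGrading T level →
  ∀ {h} → 1 ≤ h → h ≤ 3 → (∀ v → level v ≤ h) →
  ∀ {u v} → level u ≡ 0 → level v ≡ h → EqClosure (Arc T) u v →
  ∀ {p} {P : Digraph p} → T ⇝ P → P ⇝ T →
  ∃[ d ] Σ[ D ∈ Digraph d ] (d ≤ 3 * p × DualityPair T D)
graded-dual {T = T} grading {1} _ _ bounded {u = u} u≡0 v≡h w {p} (t , _) _ =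
  -- The image of `u` makes `P` nonempty, so `p` is at least 1.
  1 , point , *-mono-≤ {1} {3} (s≤s z≤n) (≤-<-trans z≤n (Fin.toℕ<n (t u)))
  , duality T point (λ G → ∃₂ (Arc G)) (λ L → arc⇒⇝ L bounded) no-arc⇒⇝point
      λ (_ , g-arc) → g-arc (proj₂ (proj₂ (walk⇒arc u≡0 v≡h w)))
  where open Graded {T = T} grading
graded-dual {T = T} grading {2} _ _ bounded {u = u} u≡0 v≡h w {p} (t , _) _ =
  2 , arrow , *-mono-≤ {2} {3} (s≤s (s≤s z≤n)) (≤-<-trans z≤n (Fin.toℕ<n (t u)))
  , duality T arrow (λ G → ∃[ z ] HasIn G z × HasOut G z) (λ L → 2-path⇒⇝ L bounded) no-2-path⇒⇝arrow
      λ (g , g-arc) →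
        let x , (a , ax) , (b , xb) = walk⇒2-path u≡0 v≡h w
        in arrow-no-2-path (g x , (g a , g-arc ax) , (g b , g-arc xb))
  where open Graded {T = T} grading
graded-dual {T = T} grading {3} _ _ bounded u≡0 v≡h w {p} {P} T⇝P P⇝T
  with j , zigzag , none ← least (zigzag? T) (proj₂ (Graded.walk⇒zigzag {T = T} grading u≡0 v≡h w)) =
  _ , cycle , size
  , duality T cycle (λ G → Zigzag G j) (λ L → zigzag⇒⇝ L bounded none) no-zigzag⇒⇝cycle
      λ T⇝cycle → cycle-no-zigzag (zigzag-hom T cycle T⇝cycle zigzag)
  where
  open Graded {T = T} grading
  open Cycle j
  j<p : suc j ≤ p
  -- Homomorphisms both ways transfer zigzags, so `j` is least for `P` as well.
  j<p = shortest-zigzag-< P (zigzag-hom T P T⇝P zigzag)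
          λ i i<j z → none i i<j (zigzag-hom P T P⇝T z)
  size : suc (suc j) + suc j ≤ 3 * p
  -- This is 2j + 3 ≤ 3(j + 1), with equality at j = 0: the source of the constant 3.
  size = begin
    suc (suc j) + suc j           ≤⟨ +-mono-≤ (s≤s (m≤n+m (suc j) j)) (m≤m+n (suc j) 0) ⟩
    (suc j + suc j) + (suc j + 0) ≡⟨ +-assoc (suc j) _ _ ⟩
    3 * suc j                     ≤⟨ *-monoʳ-≤ 3 j<p ⟩
    3 * p                         ∎
    where open ≤-Reasoning
graded-dual _ {suc (suc (suc (suc _)))} _ (s≤s (s≤s (s≤s ())))

mainTheorem10 : ∃[ c ] (∀ (n : ℕ) (T : Digraph n) (h : ℕ) →
    IsOrientedTree T → HasHeight T h → 1 ≤ h → h ≤ 3 →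
    ∀ (p : ℕ) (P : Digraph p) → P IsCoreOf T →
    ∃[ d ] Σ[ D ∈ Digraph d ] (d ≤ c * p × d ≤ c * n × DualityPair T D))
mainTheorem10 = 3 , λ
  n T h (U , tree , orientation) (level , isLevel , bounded , (top , top≡h)) 1≤h h≤3 p P core →
  let
    open OrientedTree T tree orientation
    open _IsCoreOf_ core
    bottom , bottom≡0 = IsLevel.minimum isLevel
    d , D , d≤3p , dual =
      graded-dual {T = T} (level-grading isLevel) 1≤h h≤3 bounded bottom≡0 top≡h
        (proj₁ (path bottom top)) {P = P} to from
    p≤n = injective⇒≤ (Subgraph.embed-injective subgraph)
  in d , D , d≤3p , ≤-trans d≤3p (*-monoʳ-≤ 3 p≤n) , dual
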